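{- Let $(\mathcal{I},\gamma)$ be an inference system with coaxioms on a universe $\mathcal{U}$, and let $j\in\mathcal{U}$ be a judgement. If the inference operator $F_{\mathcal{I}}$ is downward continuous, then the following are equivalent: (1) $j\in\mathit{Gen}(\mathcal{I},\gamma)$; (2) $j$ has an approximated proof tree of level $n$ in $(\mathcal{I},\gamma)$, for all $n\in\mathbb{N}$ (i.e. for each $n\in\mathbb{N}$ there is a tree in $\mathcal{T}_n$ with root $j$).
   Context: Inference systems. Fix a set $\mathcal{U}$ (the universe), whose elements are called judgements. An inference system $\mathcal{I}$ is a set of rules, i.e. pairs $\frac{Pr}{c}$ with $Pr\subseteq\mathcal{U}$ (premises, an arbitrary set) and $c\in\mathcal{U}$ (conclusion). Its inference operator is $F_{\mathcal{I}}:\wp(\mathcal{U})\to\wp(\mathcal{U})$, $F_{\mathcal{I}}(S)=\{c \mid \exists \frac{Pr}{c}\in\mathcal{I},\ Pr\subseteq S\}$. It is downward continuous if $F_{\mathcal{I}}(\bigcap_{i\in\mathbb{N}} S_i)=\bigcap_{i\in\mathbb{N}} F_{\mathcal{I}}(S_i)$ for every sequence $(S_i)_{i\in\mathbb{N}}$ of subsets of $\mathcal{U}$ totally ordered by inclusion. $\mathit{Ind}(\mathcal{I})$ and $\mathit{CoInd}(\mathcal{I})$ are the least and the greatest fixed point of $F_{\mathcal{I}}$. An inference system with coaxioms is a pair $(\mathcal{I},\gamma)$ with $\mathcal{I}$ an inference system and $\gamma\subseteq\mathcal{U}$. $\mathcal{I}_{\sqcup\gamma}=\mathcal{I}\cup\{\frac{\emptyset}{c}\mid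 c\in\gamma\}$; for $S\subseteq\mathcal{U}$, $\mathcal{I}_{\sqcap S}=\{\frac{Pr}{c}\in\mathcal{I}\mid c\in S\}$. The interpretation generated by coaxioms is $\mathit{Gen}(\mathcal{I},\gamma)=\mathit{CoInd}(\mathcal{I}_{\sqcap \mathit{Ind}(\mathcal{I}_{\sqcup\gamma})})$. Trees. For a set $A$, $A^\star$ is the set of finite strings over $A$, $\varepsilon$ the empty string. A tree language is a non-empty $L\subseteq A^\star$ such that $\alpha a\in L$ implies $\alpha\in L$ ($a\in A$). A tree labelled in a set $\Lambda$ is a function $t:L\to\Lambda$ with $L=\mathit{dom}(t)$ a tree language; its root is $t(\varepsilon)$. For $\alpha\in\mathit{dom}(t)$, $\mathit{chl}_t(\alpha)=\{\alpha a\in \mathit{dom}(t)\mid a\in A\}$. $t$ is well-founded if every subset of $\mathit{dom}(t)$ that is a chain for the prefix order is finite. $t$ is children injective if $t$ restricted to $\mathit{chl}_t(\alpha)$ is injective for all $\alpha\in\mathit{dom}(t)$. Children injective trees labelled in $\Lambda$ are considered up to renaming of alphabet symbols and can be taken in canonical form: $A=\Lambda$ and $t(\alpha a)=a$ for all $\alpha a\in\mathit{dom}(t)$. Proof trees. A proof tree in $\mathcal{I}$ is a children injective tree $t$ labelled in $\mathcal{U}$ such that for all $\alpha\in\mathit{dom}(t)$ there is a rule $\frac{Pr}{c}\in\mathcal{I}$ with $t(\alpha)=c$ and $t(\mathit{chl}_t(\alpha))=Pr$. The sets $\mathcal{T}_n$ of approximated proof trees of level $n$ in $(\mathcal{I},\gamma)$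 are defined inductively: $\mathcal{T}_0$ is the set of well-founded proof trees in $\mathcal{I}_{\sqcup\gamma}$; $\mathcal{T}_{n+1}$ consists of the trees with root $c$ whose direct subtrees are exactly the members of a family $(t_i)_{i\in Pr}$, where $\frac{Pr}{c}\in\mathcal{I}$ and, for each $i\in Pr$, $t_i\in\mathcal{T}_n$ and $t_i(\varepsilon)=i$. -}

module Defs where

open import Data.List.Base using (List; []; _∷_; _∷ʳ_; foldl)
open import Data.List.Membership.Propositional using () renaming (_∈_ to _∈ˡ_)
open import Data.List.Properties using (foldl-∷ʳ)
open import Data.List.Relation.Binary.Prefix.Heterogeneous using (Prefix)
open import Data.Nat.Base using (ℕ; zero; suc)
open import Data.Product using (Σ; ∃; ∃-syntax; _×_; _,_; proj₁; proj₂)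
open import Data.Sum.Base using (_⊎_; inj₁; inj₂; [_,_])
open import Data.Unit.Polymorphic using (⊤; tt)
open import Level using (Level; _⊔_) renaming (suc to lsuc)
open import Relation.Binary.PropositionalEquality
  using (_≡_; refl; sym; trans; cong)
open import Relation.Unary using (Pred; _∈_; _⊆_; _≐_; ⋂; Satisfiable)
open import Relation.Unary.Polymorphic using (∅)

private variable
  ℓ ℓ' : Level

-- Subsets of U are predicates, compared by mutual inclusion _≐_.

-- A set of rules is given as a small family of pairs (premises, conclusion).
-- As a predicate on Pred U ℓ × U it would make the inference operator leave
-- Pred U ℓ, because Agda's universes are predicative.
record InferenceSystem (U : Set ℓ) : Set (lsuc ℓ) where
  field
    Rule  : Set ℓ
    prems : Rule → Pred U ℓ
    concl : Rule → U

open InferenceSystem public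

F : {U : Set ℓ} → InferenceSystem U → Pred U ℓ' → Pred U (ℓ ⊔ ℓ')
F I S c = ∃[ r ] concl I r ≡ c × prems I r ⊆ S

TotallyOrdered : {U : Set ℓ} → (ℕ → Pred U ℓ) → Set ℓ
TotallyOrdered S = ∀ i k → (S i ⊆ S k) ⊎ (S k ⊆ S i)

DownwardContinuous : {U : Set ℓ} → (Pred U ℓ → Pred U ℓ) → Set (lsuc ℓ)
DownwardContinuous {ℓ} {U} Φ =
  (S : ℕ → Pred U ℓ) → TotallyOrdered S → Φ (⋂ ℕ S) ≐ ⋂ ℕ (λ i → Φ (S i))

data Ind {U : Set ℓ} (I : InferenceSystem U) : Pred U ℓ where
  fold : F I (Ind I) ⊆ Ind I

-- The greatest fixed point, as the union of all post-fixed points.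
CoInd : {U : Set ℓ} → InferenceSystem U → Pred U (lsuc ℓ)
CoInd {ℓ} {U} I c = Σ (Pred U ℓ) λ S → S ⊆ F I S × c ∈ S

module FixedPoints {U : Set ℓ} (I : InferenceSystem U) where

  Ind-fixed : F I (Ind I) ≐ Ind I
  Ind-fixed = fold , λ { (fold x) → x }

  Ind-least : {S : Pred U ℓ'} → F I S ⊆ S → Ind I ⊆ S
  Ind-least closed (fold (r , e , h)) =
    closed (r , e , λ p → Ind-least closed (h p))

  CoInd-fixed : F I (CoInd I) ≐ CoInd I
  CoInd-fixed = backward , forward
    where
    forward : CoInd I ⊆ F I (CoInd I)
    forward (S , post , s) with post s
    ... | r , e , h = r , e , λ p → S , post , h p

    backward : F I (CoInd I) ⊆ CoInd I
    backward {c} (r , e , h) = S , post , inj₁ refl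
      where
      T : Pred U ℓ
      T z = ∃[ x ] Σ (x ∈ prems I r) λ p → z ∈ proj₁ (h p)
      S : Pred U ℓ
      S z = c ≡ z ⊎ z ∈ T
      post : S ⊆ F I S
      post (inj₁ refl) =
        r , e , λ {x} p → inj₂ (x , p , proj₂ (proj₂ (h p)))
      post (inj₂ (x , p , s)) with proj₁ (proj₂ (h p)) s
      ... | r′ , e′ , h′ = r′ , e′ , λ q → inj₂ (x , p , h′ q)

  -- S may live in any universe: it is replaced by the subset of judgements
  -- reached from c by finitely many premise steps, which lies in Pred U ℓ.
  CoInd-greatest : {S : Pred U ℓ'} → S ⊆ F I S → S ⊆ CoInd I
  CoInd-greatest {S = S} post {c} s₀ = Reached , reached-post , zero , tt , refl
    where
    Path : ∀ {x} → x ∈ S → ℕ → Set ℓ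
    Path s zero    = ⊤
    Path s (suc n) with post s
    ... | r , _ , h = ∃[ y ] Σ (y ∈ prems I r) λ p → Path (h p) n

    end : ∀ {x} (s : x ∈ S) n → Path s n → ∃ S
    end s zero    _           = _ , s
    end s (suc n) (y , p , π) = end (proj₂ (proj₂ (post s)) p) n π

    Reached : Pred U ℓ
    Reached z = ∃[ n ] Σ (Path s₀ n) λ π → proj₁ (end s₀ n π) ≡ z

    extend : ∀ {x} (s : x ∈ S) n (π : Path s n) {y} →
             y ∈ prems I (proj₁ (post (proj₂ (end s n π)))) →
             Σ (Path s (suc n)) λ π′ → proj₁ (end s (suc n) π′) ≡ y
    extend s zero    _           p = (_ , p , tt) , refl
    extend s (suc n) (y , q , π) p
      with extend (proj₂ (proj₂ (post s)) q) n π p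
    ... | π′ , e = (y , q , π′) , e

    reached-post : Reached ⊆ F I Reached
    reached-post (n , π , refl) =
      let r , e , _ = post (proj₂ (end s₀ n π))
      in  r , e , λ p → suc n , extend s₀ n π p

infixl 6 _⊔ᶜ_ _⊓ᶜ_

_⊔ᶜ_ : {U : Set ℓ} → InferenceSystem U → Pred U ℓ → InferenceSystem U
I ⊔ᶜ γ = record
  { Rule  = Rule I ⊎ ∃ γ
  ; prems = [ prems I , (λ _ → ∅) ]
  ; concl = [ concl I , proj₁ ]
  }

_⊓ᶜ_ : {U : Set ℓ} → InferenceSystem U → Pred U ℓ → InferenceSystem U
I ⊓ᶜ S = record
  { Rule  = ∃[ r ] concl I r ∈ S
  ; prems = λ (r , _) → prems I r
  ; concl = λ (r , _) → concl I r
  }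

Gen : {U : Set ℓ} → InferenceSystem U → Pred U ℓ → Pred U (lsuc ℓ)
Gen I γ = CoInd (I ⊓ᶜ Ind (I ⊔ᶜ γ))

-- Children injective trees labelled in Λ, in canonical form: the alphabet is Λ
-- and t(αa) = a, so that a tree is determined by its domain and its root.
record Tree (Λ : Set ℓ) : Set (lsuc ℓ) where
  field
    dom           : Pred (List Λ) ℓ
    root          : Λ
    nonempty      : Satisfiable dom
    prefix-closed : ∀ α a → α ∷ʳ a ∈ dom → α ∈ dom

open Tree public

module _ {Λ : Set ℓ} where

  -- The function t, only meaningful on dom t: the last symbol of the string,
  -- or the root if the string is empty.
  label : Tree Λ → List Λ → Λ
  label t = foldl (λ _ a → a) (root t)

  label-ε : ∀ t → label t [] ≡ root t
  label-ε t = refl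

  label-∷ʳ : ∀ t α a → label t (α ∷ʳ a) ≡ a
  label-∷ʳ t α a = foldl-∷ʳ (λ _ b → b) (root t) a α

  chl : Tree Λ → List Λ → Pred (List Λ) ℓ
  chl t α β = β ∈ dom t × ∃[ a ] β ≡ α ∷ʳ a

  children-injective : ∀ t α {β β′} → β ∈ chl t α → β′ ∈ chl t α →
                       label t β ≡ label t β′ → β ≡ β′
  children-injective t α (_ , a , refl) (_ , b , refl) e =
    cong (α ∷ʳ_) (trans (sym (label-∷ʳ t α a)) (trans e (label-∷ʳ t α b)))

  image : Tree Λ → Pred (List Λ) ℓ → Pred Λ ℓ
  image t B x = ∃[ β ] β ∈ B × label t β ≡ x

  Chain : Pred (List Λ) ℓ → Set ℓ
  Chain C = ∀ α β → α ∈ C → β ∈ C → Prefix _≡_ α β ⊎ Prefix _≡_ β α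

  Finite : Pred (List Λ) ℓ → Set ℓ
  Finite C = ∃[ αs ] C ≐ (_∈ˡ αs)

  WellFounded : Tree Λ → Set (lsuc ℓ)
  WellFounded t = (C : Pred (List Λ) ℓ) → C ⊆ dom t → Chain C → Finite C

  infix 4 _≈_ _DirectSubtreeOf_

  _≈_ : Tree Λ → Tree Λ → Set ℓ
  s ≈ t = root s ≡ root t × dom s ≐ dom t

  _DirectSubtreeOf_ : Tree Λ → Tree Λ → Set ℓ
  s DirectSubtreeOf t =
    ∃[ a ] a ∷ [] ∈ dom t × root s ≡ a × dom s ≐ (λ β → a ∷ β ∈ dom t)

IsProofTree : {U : Set ℓ} → InferenceSystem U → Pred (Tree U) ℓ
IsProofTree I t = ∀ α → α ∈ dom t →
  ∃[ r ] label t α ≡ concl I r × image t (chl t α) ≐ prems I r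

-- In the successor case, (tᵢ) is indexed by the elements i of Pr together with
-- a proof p of membership; the last two conditions make the tree independent
-- of p up to _≈_, since a direct subtree is determined by its root.
𝒯 : {U : Set ℓ} → InferenceSystem U → Pred U ℓ → ℕ → Pred (Tree U) (lsuc ℓ)
𝒯 I γ zero    t = IsProofTree (I ⊔ᶜ γ) t × WellFounded t
𝒯 {U = U} I γ (suc n) t =
  ∃[ r ] root t ≡ concl I r ×
  Σ (∀ i → i ∈ prems I r → Tree U) λ tᵢ →
    (∀ i p → tᵢ i p ∈ 𝒯 I γ n × label (tᵢ i p) [] ≡ i) ×
    (∀ i p → tᵢ i p DirectSubtreeOf t) ×
    (∀ s → s DirectSubtreeOf t → ∃[ i ] ∃[ p ] s ≈ tᵢ i p)

{-# OPTIONS --safe #-}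
module Submission where

-- Let G = Ind(I ⊔ γ). Since G is closed under F_I, its iterates F_Iⁿ(G) decrease,
-- and downward continuity makes their intersection a post-fixed point of F_I
-- inside G; as Gen(I,γ) lies in every iterate, Gen(I,γ) = ⋂ₙ F_Iⁿ(G). By
-- induction on n, F_Iⁿ(G) is the set of roots of trees in 𝒯ₙ. For n = 0, a proof
-- tree whose root is outside G has at each node outside G a child outside G,
-- hence an infinite branch.

open import Defs
open import Axiom.ExcludedMiddle using (ExcludedMiddle)
open import Data.Empty using (⊥-elim)
open import Data.List.Base using (List; []; _∷_; _∷ʳ_; length; map)
open import Data.List.Extrema.Nat using (argmax; f[xs]≤f[argmax])
open import Data.List.Membership.Propositional using () renaming (_∈_ to _∈ˡ_)
open import Data.List.Membership.Propositional.Properties using (∈-map⁺; ∈-map⁻)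
open import Data.List.Properties using (length-++)
import Data.List.Relation.Binary.Pointwise as Pointwise
open import Data.List.Relation.Binary.Prefix.Heterogeneous using (Prefix; _++ᵖ_; tail)
import Data.List.Relation.Binary.Prefix.Heterogeneous.Properties as Prefix
open import Data.List.Relation.Unary.All using () renaming (lookup to lookupAll)
open import Data.List.Relation.Unary.Any using (here; there)
open import Data.Nat.Base using (ℕ; zero; suc; _≤_; z≤n; s≤s; _≤′_; ≤′-refl; ≤′-step)
open import Data.Nat.GeneralisedArithmetic using () renaming (fold to iterate)
open import Data.Nat.Properties using (+-comm; ≤-total; ≤-trans; ≤⇒≤′; 1+n≰n)
open import Data.Product using (Σ; ∃-syntax; _×_; _,_; proj₁; proj₂)
open import Data.Sum.Base using (inj₁; inj₂) renaming (map to map-⊎)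
open import Data.Unit.Polymorphic using (⊤; tt)
open import Function.Base using (_∘_)
open import Function.Bundles using (_⇔_; mk⇔)
open import Level using (Level)
open import Relation.Binary.Core using (Rel)
open import Relation.Binary.Definitions using (Reflexive; Transitive)
open import Relation.Binary.PropositionalEquality
  using (_≡_; refl; sym; trans; cong; subst)
open import Relation.Nullary using (¬_; yes; no)
open import Relation.Nullary.Decidable using (recompute; recompute-constant; decidable-stable)
open import Relation.Unary using (Pred; _∈_; _∉_; _⊆_; ⋂)

private variable
  a ℓ : Level

-- Serves two orders: the prefix order along a branch and reversed inclusion between iterates.
stepwise⇒monotone : {A : Set a} {R : Rel A ℓ} → Reflexive R → Transitive R →
  (f : ℕ → A) → (∀ n → R (f n) (f (suc n))) → ∀ {m n} → m ≤ n → R (f m) (f n)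
stepwise⇒monotone {R = R} R-refl R-trans f step = go ∘ ≤⇒≤′
  where
  go : ∀ {m n} → m ≤′ n → R (f m) (f n)
  go ≤′-refl       = R-refl
  go (≤′-step m≤n) = R-trans (go m≤n) (step _)

F-mono : {U : Set ℓ} (I : InferenceSystem U) {S T : Pred U ℓ} → S ⊆ T → F I S ⊆ F I T
F-mono I S⊆T (r , e , h) = r , e , λ p → S⊆T (h p)

-- Trees: grafting subtrees below a root, and infinite branches

module _ {Λ : Set ℓ} where

  []∈dom : (t : Tree Λ) → [] ∈ dom t
  []∈dom t = go (dom t) (prefix-closed t) (proj₁ (nonempty t)) (proj₂ (nonempty t))
    where
    -- Prefix closure drops the last symbol, but recursion on the string strips the first.
    -- Generalising over `D` lets the recursion pass to the language below `a`; its empty string is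
    -- `a ∷ []` in `D`, one step from the root.
    go : (D : Pred (List Λ) ℓ) → (∀ α a → α ∷ʳ a ∈ D → α ∈ D) → ∀ α → α ∈ D → [] ∈ D
    go D closed []      d = d
    go D closed (a ∷ α) d =
      closed [] a (go (λ β → a ∷ β ∈ D) (λ β → closed (a ∷ β)) α d)

  module _ (c : Λ) (P : Pred Λ ℓ) (ts : ∀ i → i ∈ P → Tree Λ) where

    GraftDom : Pred (List Λ) ℓ
    GraftDom []      = ⊤
    GraftDom (i ∷ α) = Σ (i ∈ P) λ p → α ∈ dom (ts i p)

    graft : Tree Λ
    graft = record
      { dom           = GraftDom
      ; root          = c
      ; nonempty      = [] , tt
      ; prefix-closed = closed
      }
      where
      closed : ∀ α a → α ∷ʳ a ∈ GraftDom → α ∈ GraftDom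
      closed []      a _       = tt
      closed (i ∷ α) a (p , d) = p , prefix-closed (ts i p) α a d

    -- P is proof-relevant, so the trees must not depend on the membership proof
    -- for the graft to have a single subtree per premise.
    module Graft (constant : ∀ i p q → ts i p ≡ ts i q)
                 (root-ts : ∀ i p → root (ts i p) ≡ i) where

      dom-at : ∀ {i α} p → i ∷ α ∈ GraftDom → α ∈ dom (ts i p)
      dom-at {i} {α} p (q , d) = subst (λ t → α ∈ dom t) (constant i q p) d

      -- The label of a non-empty string is its last symbol, whatever the stored root; only at the
      -- root of the subtree does `root-ts` have to reconcile the two.
      label-∷ : ∀ i p α → label graft (i ∷ α) ≡ label (ts i p) α
      label-∷ i p []      = sym (root-ts i p)
      label-∷ i p (_ ∷ _) = refl

      subtree : ∀ i p → ts i p DirectSubtreeOf graft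
      subtree i p = i , (p , []∈dom (ts i p)) , root-ts i p , (p ,_) , dom-at p

      subtree⁻ : ∀ s → s DirectSubtreeOf graft → ∃[ i ] ∃[ p ] s ≈ ts i p
      subtree⁻ s (i , (p , _) , e , s⊆ , ⊆s) =
        i , p , trans e (sym (root-ts i p)) ,
        (λ d → dom-at p (s⊆ d)) , (λ d → ⊆s (p , d))

      graft-isProofTree : (J : InferenceSystem Λ) (r : Rule J) →
        c ≡ concl J r → P ≡ prems J r →
        (∀ i p → IsProofTree J (ts i p)) → IsProofTree J graft
      graft-isProofTree J r e refl proofs [] _ = r , e , to , from
        where
        to : image graft (chl graft []) ⊆ P
        to (_ , ((p , _) , i , refl) , refl) = p
        from : P ⊆ image graft (chl graft [])
        from {i} p = i ∷ [] , ((p , []∈dom (ts i p)) , i , refl) , refl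
      graft-isProofTree J r e refl proofs (i ∷ α) (p , d)
        with proofs i p α d
      ... | r′ , e′ , im⊆ , ⊆im = r′ , trans (label-∷ i p α) e′ , to , from
        where
        to : image graft (chl graft (i ∷ α)) ⊆ prems J r′
        to (_ , (d′ , b , refl) , refl) =
          im⊆ (_ , (dom-at p d′ , b , refl) , sym (label-∷ i p (α ∷ʳ b)))
        from : prems J r′ ⊆ image graft (chl graft (i ∷ α))
        from q with ⊆im q
        ... | _ , (d′ , b , refl) , e″ =
          _ , ((p , d′) , b , refl) , trans (label-∷ i p (α ∷ʳ b)) e″

      -- All non-empty strings in a chain start with the same symbol i, so all but
      -- the empty one come from a chain in the subtree at i.
      graft-wellFounded : ExcludedMiddle ℓ →
        (∀ i p → WellFounded (ts i p)) → WellFounded graft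
      graft-wellFounded em wf C C⊆ chain = finite
        where
        add-[] : (αs : List (List Λ)) → (∀ {α} → α ∈ˡ αs → α ∈ C) →
                 (∀ {i α} → i ∷ α ∈ C → i ∷ α ∈ˡ αs) → Finite C
        add-[] αs αs⊆ ⊆αs with em {[] ∈ C}
        ... | yes c = [] ∷ αs ,
          (λ { {[]} _ → here refl ; {_ ∷ _} c′ → there (⊆αs c′) }) ,
          (λ { (here refl) → c ; (there m) → αs⊆ m })
        ... | no ¬c = αs ,
          (λ { {[]} c′ → ⊥-elim (¬c c′) ; {_ ∷ _} c′ → ⊆αs c′ }) , αs⊆

        same-head : ∀ {i j α β} → i ∷ α ∈ C → j ∷ β ∈ C → j ≡ i
        same-head m n with chain _ _ m n
        ... | inj₁ (e Prefix.∷ _) = sym e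
        ... | inj₂ (e Prefix.∷ _) = e

        finite : Finite C
        finite with em {∃[ i ] ∃[ α ] i ∷ α ∈ C}
        ... | no ¬∃ = add-[] [] (λ ()) (λ m → ⊥-elim (¬∃ (_ , _ , m)))
        ... | yes (i , α , m)
          -- The membership proof of `i` found in `m` fixes one subtree; `dom-at` moves the other
          -- strings of the chain into that same subtree.
          with wf i (proj₁ (C⊆ m)) (λ β → i ∷ β ∈ C) (λ n → dom-at _ (C⊆ n))
                  (λ β γ n n′ → map-⊎ tail tail (chain _ _ n n′))
        ... | βs , ⊆βs , βs⊆ = add-[] (map (i ∷_) βs) from to
          where
          from : ∀ {γ} → γ ∈ˡ map (i ∷_) βs → γ ∈ C
          from n with ∈-map⁻ (i ∷_) n
          ... | _ , n′ , refl = βs⊆ n′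
          to : ∀ {j γ} → j ∷ γ ∈ C → j ∷ γ ∈ˡ map (i ∷_) βs
          to n with same-head m n
          ... | refl = ∈-map⁺ (i ∷_) (⊆βs n)

  -- The nodes of the branch form a chain. Were it finite, their lengths would be bounded, yet the
  -- node numbered `n` has length at least `n`.
  no-infinite-branch : (t : Tree Λ) → WellFounded t → (b : ℕ → List Λ) →
    (∀ n → b n ∈ dom t) → ¬ (∀ n → ∃[ x ] b (suc n) ≡ b n ∷ʳ x)
  no-infinite-branch t wf b b∈ step with wf C C⊆ chain
    where
    C : Pred (List Λ) ℓ
    C α = ∃[ n ] b n ≡ α
    C⊆ : C ⊆ dom t
    C⊆ (n , refl) = b∈ n
    b-mono : ∀ {m n} → m ≤ n → Prefix _≡_ (b m) (b n)
    b-mono = stepwise⇒monotone {R = Prefix _≡_} ≼-refl (Prefix.trans trans) b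
      λ n → subst (Prefix _≡_ (b n)) (sym (proj₂ (step n))) (≼-refl ++ᵖ _)
      where
      ≼-refl : Reflexive (Prefix {A = Λ} _≡_)
      ≼-refl = Prefix.fromPointwise (Pointwise.refl refl)
    chain : Chain C
    chain _ _ (m , refl) (n , refl) = map-⊎ b-mono b-mono (≤-total m n)
  ... | αs , ⊆αs , _ = 1+n≰n (≤-trans (long (suc bound)) (bounded (suc bound)))
    where
    bound : ℕ
    bound = length (argmax length [] αs)
    bounded : ∀ n → length (b n) ≤ bound
    bounded n = lookupAll (f[xs]≤f[argmax] {f = length} [] αs) (⊆αs (n , refl))
    long : ∀ n → n ≤ length (b n)
    long zero = z≤n
    long (suc n) with step n
    ... | x , e rewrite e | length-++ (b n) {x ∷ []} | +-comm (length (b n)) 1 = s≤s (long n)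

-- Iterates of the inference operator and their intersection

module _ {U : Set ℓ} (I : InferenceSystem U) (γ : Pred U ℓ) where

  Approx : ℕ → Pred U ℓ
  Approx zero    = Ind (I ⊔ᶜ γ)
  Approx (suc n) = F I (Approx n)

  -- Rules of `I` are also rules of `I ⊔ᶜ γ`, so the first inclusion is closure of `Ind`;
  -- monotonicity propagates it.
  Approx-step : ∀ n → Approx (suc n) ⊆ Approx n
  Approx-step zero    (r , e , h) = fold (inj₁ r , e , h)
  Approx-step (suc n) = F-mono I (Approx-step n)

  Approx-totallyOrdered : TotallyOrdered Approx
  -- The arguments of `≤-total` are swapped because a larger index gives a smaller set.
  Approx-totallyOrdered i k = map-⊎ antitone antitone (≤-total k i)
    where
    antitone : ∀ {m n} → m ≤ n → Approx n ⊆ Approx m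
    antitone = stepwise⇒monotone {R = λ S T → T ⊆ S} (λ x → x)
      (λ T⊆S V⊆T x → T⊆S (V⊆T x)) Approx Approx-step

  -- Each post-fixed point of the restricted system lies in every iterate: the restriction on
  -- conclusions gives the base case, and unfolding one rule gives each further step.
  Gen⊆⋂Approx : Gen I γ ⊆ ⋂ ℕ Approx
  Gen⊆⋂Approx (S , post , s) n = S⊆Approx n s
    where
    S⊆Approx : ∀ n → S ⊆ Approx n
    S⊆Approx zero    s with post s
    ... | (r , c∈) , refl , _ = c∈
    S⊆Approx (suc n) s with post s
    ... | (r , _) , e , h = r , e , λ p → S⊆Approx n (h p)

  ⋂Approx⊆Gen : DownwardContinuous (F I) → ⋂ ℕ Approx ⊆ Gen I γ
  ⋂Approx⊆Gen cont s = ⋂ ℕ Approx , post , s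
    where
    post : ⋂ ℕ Approx ⊆ F (I ⊓ᶜ Ind (I ⊔ᶜ γ)) (⋂ ℕ Approx)
    post x with proj₂ (cont Approx Approx-totallyOrdered) (x ∘ suc)
    ... | r , refl , h = (r , x zero) , refl , h

-- Roots of approximated proof trees are the members of the iterates

module _ {ℓ} (em : ExcludedMiddle ℓ) {U : Set ℓ} where

  wellFounded⇒root∈Ind : (J : InferenceSystem U) (t : Tree U) →
    IsProofTree J t → WellFounded t → root t ∈ Ind J
  wellFounded⇒root∈Ind J t proof wf = decidable-stable em λ root∉ →
    let branch : ℕ → Bad
        branch = iterate ([] , []∈dom t , root∉) (proj₁ ∘ next)
    in  no-infinite-branch t wf (proj₁ ∘ branch) (proj₁ ∘ proj₂ ∘ branch)
          (proj₂ ∘ next ∘ branch)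
    where
    -- Bundling a node with its proofs makes `next` a function, so the branch arises by plain
    -- iteration; excluded middle supplies the offending premise as a witness.
    Bad : Set ℓ
    Bad = ∃[ α ] α ∈ dom t × label t α ∉ Ind J
    next : (x : Bad) → Σ Bad λ y → ∃[ a ] proj₁ y ≡ proj₁ x ∷ʳ a
    next (α , d , α∉) with proof α d
    ... | r , e , _ , ⊆im with em {∃[ x ] x ∈ prems J r × x ∉ Ind J}
    ... | no ¬∃ = ⊥-elim (α∉ (fold (r , sym e , λ p →
            decidable-stable em λ x∉ → ¬∃ (_ , p , x∉))))
    ... | yes (x , p , x∉) with ⊆im p
    -- Matching `refl` replaces the premise `x` by the label of the child `β`, so `x∉` says that
    -- this child is again bad.
    ... | β , (d′ , a , β≡) , refl = (β , d′ , x∉) , a , β≡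

  -- Recomputing the membership proof makes the chosen subtree depend on the
  -- premise only.
  module Derivation (J : InferenceSystem U) where

    derivation : ∀ {c} → c ∈ Ind J → Tree U
    derivation {c} (fold (r , e , h)) =
      graft c (prems J r) λ i p → derivation (h (recompute em p))

    root-derivation : ∀ {c} (d : c ∈ Ind J) → root (derivation d) ≡ c
    root-derivation (fold _) = refl

    module Step (c : U) (r : Rule J) (h : prems J r ⊆ Ind J) =
      Graft c (prems J r) (λ i p → derivation (h (recompute em p)))
        (λ i p q → cong (λ p′ → derivation (h p′)) (recompute-constant em p q))
        (λ i p → root-derivation (h (recompute em p)))

    derivation-isProofTree : ∀ {c} (d : c ∈ Ind J) → IsProofTree J (derivation d)
    derivation-isProofTree {c} (fold (r , e , h)) =
      Step.graft-isProofTree c r h J r (sym e) refl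
        λ i p → derivation-isProofTree (h (recompute em p))

    derivation-wellFounded : ∀ {c} (d : c ∈ Ind J) → WellFounded (derivation d)
    derivation-wellFounded {c} (fold (r , e , h)) =
      Step.graft-wellFounded c r h em
        λ i p → derivation-wellFounded (h (recompute em p))

  module _ (I : InferenceSystem U) (γ : Pred U ℓ) where

    𝒯⇒Approx : ∀ n t → t ∈ 𝒯 I γ n → root t ∈ Approx I γ n
    𝒯⇒Approx zero    t (proof , wf) = wellFounded⇒root∈Ind _ t proof wf
    𝒯⇒Approx (suc n) t (r , e , ts , ts∈ , _) = r , sym e , λ {i} p →
      subst (Approx I γ n) (proj₂ (ts∈ i p)) (𝒯⇒Approx n (ts i p) (proj₁ (ts∈ i p)))

    Approx⇒𝒯 : ∀ n {c} → c ∈ Approx I γ n → ∃[ t ] (t ∈ 𝒯 I γ n × root t ≡ c)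
    Approx⇒𝒯 zero d = derivation d ,
      (derivation-isProofTree d , derivation-wellFounded d) , root-derivation d
      where open Derivation (I ⊔ᶜ γ)
    Approx⇒𝒯 (suc n) {c} (r , e , h) =
      graft c (prems I r) ts , (r , sym e , ts , (λ i p → proj₂ (subproof p)) , subtree , subtree⁻) , refl
      where
      subproof : ∀ {i} → i ∈ prems I r → ∃[ t ] (t ∈ 𝒯 I γ n × root t ≡ i)
      -- As in `Derivation`, `recompute` erases the dependence on the membership proof, giving the
      -- constancy that `Graft` requires.
      subproof p = Approx⇒𝒯 n (h (recompute em p))
      ts : ∀ i → i ∈ prems I r → Tree U
      ts i p = proj₁ (subproof p)
      open Graft c (prems I r) ts
        (λ i p q → cong (λ p′ → proj₁ (Approx⇒𝒯 n (h p′))) (recompute-constant em p q))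
        (λ i p → proj₂ (proj₂ (subproof p)))

corollary4p12 : {ℓ : Level} → ExcludedMiddle ℓ →
    {U : Set ℓ} (I : InferenceSystem U) (γ : Pred U ℓ) (j : U) →
    DownwardContinuous (F I) →
    j ∈ Gen I γ ⇔ (∀ (n : ℕ) → ∃[ t ] (t ∈ 𝒯 I γ n × label t [] ≡ j))
corollary4p12 em I γ j cont = mk⇔
  (λ j∈ n → Approx⇒𝒯 em I γ n (Gen⊆⋂Approx I γ j∈ n))
  (λ trees → ⋂Approx⊆Gen I γ cont λ n →
    let t , t∈ , e = trees n
    in  subst (Approx I γ n) e (𝒯⇒Approx em I γ n t t∈))
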